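{- Let $\mathcal{T}$ be an increasing tree of depth $D$, i.e. $c(u)\le c(v)$ whenever $u$ is an ancestor of $v$. Then the online algorithm \textsc{Noadd} is $D$-competitive for MLAPD on $\mathcal{T}$: for every request set $\mathcal{R}$, the total cost of the schedule produced by \textsc{Noadd} is at most $D$ times the cost of an optimal (offline) schedule.
   Context: Multi-level aggregation problem with deadlines (MLAPD): an instance is a rooted tree $\mathcal{T}$ with root $r$ and positive node costs $c(v)>0$, together with a set $\mathcal{R}$ of requests $\rho=(v,a,d)$, each issued at a node $v$, with arrival time $a$ and deadline $d\ge a$ (deadlines are assumed distinct). A service is a pair $(S,t)$ where $S$ is a subtree of $\mathcal{T}$ containing $r$ (so if $v\in S$ then all ancestors of $v$ are in $S$) and $t$ is the transmission time; it costs $c(S)=\sum_{u\in S}c(u)$. A request $(v,a,d)$ is satisfied by $(S,t)$ if $v\in S$ and $a\le t\le d$. A schedule is a set of services; it is feasible if every request is satisfied by some service; its cost is the sum of its services' costs. Online: requests are revealed at their arrival times, the tree is known in advance. The depth $D$ is the maximum number of nodes on a root-to-leaf path. For a request $\rho$ issued at $v$, $P_\rho$ denotes the set of nodes on the path from $r$ to $v$. An algorithm is $c$-competitive if its cost is at most $c$ times the optimal cost on every instance. \textsc{Noadd}: whenever a request $\rho$ that has not yet been satisfied by a previous transmission reaches its deadline $d_\rho$, it transmits the service $(P_\rho,d_\rho)$ and nothing else. -}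

module Defs where

open import Level using (Level; _⊔_; suc; 0ℓ)
open import Algebra.Bundles using (CommutativeRing)
open import Data.Bool.Base using (if_then_else_)
open import Data.Fin.Base using (Fin)
open import Data.Fin.Properties using (_≟_)
open import Data.List.Base using (List; []; _∷_; map; filter; foldl; foldr; tabulate; concat)
open import Data.List.Relation.Unary.All using (All)
open import Data.List.Relation.Unary.AllPairs using (AllPairs)
open import Data.List.Relation.Unary.Any using (Any; any?)
open import Data.Nat.Base as ℕ using (ℕ)
open import Data.Product.Base using (_×_; _,_)
open import Relation.Binary.Bundles using (DecTotalOrder)
open import Relation.Binary.Core using (Rel)
open import Relation.Binary.PropositionalEquality.Core using (refl)
open import Relation.Binary.Structures using (IsTotalOrder)
open import Relation.Nullary.Decidable.Core using (Dec; yes; no; does; _×-dec_)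
open import Relation.Nullary.Negation.Core using (¬_)
open import Relation.Unary using (Pred; Decidable)
import Algebra.Definitions.RawMonoid as RawMonoidDefs
import Data.List.Sort as Sort
import Relation.Binary.Construct.On as On

-- The standard library has no real numbers.  Costs are taken in an arbitrary
-- totally ordered commutative ring and times in an arbitrary decidable total
-- order; the (classical) reals are an instance of both.

record OrderedCommutativeRing (c ℓ₁ ℓ₂ : Level) : Set (suc (c ⊔ ℓ₁ ⊔ ℓ₂)) where
  infix 4 _≤_ _<_
  field
    commutativeRing : CommutativeRing c ℓ₁
  open CommutativeRing commutativeRing public
  field
    _≤_          : Rel Carrier ℓ₂
    isTotalOrder : IsTotalOrder _≈_ _≤_
    +-monoˡ-≤    : ∀ z {x y} → x ≤ y → x + z ≤ y + z
    *-nonNeg     : ∀ {x y} → 0# ≤ x → 0# ≤ y → 0# ≤ x * y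

  _<_ : Rel Carrier (ℓ₁ ⊔ ℓ₂)
  x < y = x ≤ y × ¬ (x ≈ y)

  fromℕ : ℕ → Carrier
  fromℕ n = n ×ⁿ 1#
    where open RawMonoidDefs +-rawMonoid using () renaming (_×_ to _×ⁿ_)

  sum : List Carrier → Carrier
  sum = foldr _+_ 0#

-- Finite rooted trees; a node of a tree is the sequence of child indices
-- leading to it from the root.

data Tree : Set where
  node : (k : ℕ) → (Fin k → Tree) → Tree

data Node : Tree → Set where
  root  : ∀ {k ts} → Node (node k ts)
  child : ∀ {k ts} (i : Fin k) → Node (ts i) → Node (node k ts)

rootOf : (𝒯 : Tree) → Node 𝒯
rootOf (node k ts) = root

nodes : (𝒯 : Tree) → List (Node 𝒯)
nodes (node k ts) = root ∷ concat (tabulate λ i → map (child i) (nodes (ts i)))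

-- Counts nodes, not edges: a single-node tree has depth 1.
depth : Tree → ℕ
depth (node k ts) = ℕ.suc (foldr ℕ._⊔_ 0 (tabulate λ i → depth (ts i)))

-- u ≼ v: u is an ancestor of v or v itself, i.e. u is on the path from the
-- root to v.
infix 4 _≼_ _≼?_

data _≼_ : {𝒯 : Tree} → Node 𝒯 → Node 𝒯 → Set where
  root≼  : ∀ {k ts} {v : Node (node k ts)} → root ≼ v
  child≼ : ∀ {k} {ts : Fin k → Tree} {i} {u v : Node (ts i)} →
           u ≼ v → child {ts = ts} i u ≼ child i v

≼-trans : ∀ {𝒯} {u v w : Node 𝒯} → u ≼ v → v ≼ w → u ≼ w
≼-trans root≼      q          = root≼
≼-trans (child≼ p) (child≼ q) = child≼ (≼-trans p q)

rootOf≼ : ∀ {𝒯} (v : Node 𝒯) → rootOf 𝒯 ≼ v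
rootOf≼ {node k ts} v = root≼

_≼?_ : ∀ {𝒯} (u v : Node 𝒯) → Dec (u ≼ v)
root      ≼? v         = yes root≼
child i u ≼? root      = no λ ()
child i u ≼? child j v with i ≟ j
... | no i≢j   = no λ { (child≼ _) → i≢j refl }
... | yes refl with u ≼? v
...   | yes p = yes (child≼ p)
...   | no ¬p = no λ { (child≼ p) → ¬p p }

-- Subtrees containing the root, as decidable sets of nodes.
record Subtree (𝒯 : Tree) : Set₁ where
  field
    Member    : Pred (Node 𝒯) 0ℓ
    member?   : Decidable Member
    root∈     : Member (rootOf 𝒯)
    ancestor∈ : ∀ {u v} → u ≼ v → Member v → Member u

infix 4 _∈_
_∈_ : ∀ {𝒯} → Node 𝒯 → Subtree 𝒯 → Set
v ∈ S = Subtree.Member S v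

path : ∀ {𝒯} → Node 𝒯 → Subtree 𝒯
path v = record
  { Member    = _≼ v
  ; member?   = _≼? v
  ; root∈     = rootOf≼ v
  ; ancestor∈ = ≼-trans
  }

module MLAPD
  {a ℓ₁ ℓ₂ b ℓ₃ ℓ₄ : Level}
  (time : DecTotalOrder a ℓ₁ ℓ₂)
  (K : OrderedCommutativeRing b ℓ₃ ℓ₄)
  where

  open DecTotalOrder time public using ()
    renaming (Carrier to Time; _≈_ to _≈ᵗ_; _≤_ to _≤ᵗ_; _≤?_ to _≤ᵗ?_)
  open OrderedCommutativeRing K public
    using (_≤_; _<_; _*_; 0#; fromℕ; sum) renaming (Carrier to Cost)

  record Request (𝒯 : Tree) : Set (a ⊔ ℓ₂) where
    field
      location         : Node 𝒯
      arrival          : Time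
      deadline         : Time
      arrival≤deadline : arrival ≤ᵗ deadline

  open Request public

  DistinctDeadlines : ∀ {𝒯} → List (Request 𝒯) → Set (a ⊔ ℓ₁ ⊔ ℓ₂)
  DistinctDeadlines = AllPairs λ ρ σ → ¬ (deadline ρ ≈ᵗ deadline σ)

  record RequestSet (𝒯 : Tree) : Set (a ⊔ ℓ₁ ⊔ ℓ₂) where
    field
      requests          : List (Request 𝒯)
      distinctDeadlines : DistinctDeadlines requests

  open RequestSet public

  record Service (𝒯 : Tree) : Set (suc 0ℓ ⊔ a) where
    constructor _at_
    field
      subtree      : Subtree 𝒯
      transmission : Time

  open Service public

  -- Repeated services are allowed and are paid for each time, so the
  -- minimum cost is the same as over sets of services.
  Schedule : Tree → Set (suc 0ℓ ⊔ a)
  Schedule 𝒯 = List (Service 𝒯)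

  Satisfies : ∀ {𝒯} → Request 𝒯 → Service 𝒯 → Set ℓ₂
  Satisfies ρ s =
    location ρ ∈ subtree s × arrival ρ ≤ᵗ transmission s × transmission s ≤ᵗ deadline ρ

  satisfies? : ∀ {𝒯} (ρ : Request 𝒯) → Decidable (Satisfies ρ)
  satisfies? ρ s =
    Subtree.member? (subtree s) (location ρ)
      ×-dec (arrival ρ ≤ᵗ? transmission s)
      ×-dec (transmission s ≤ᵗ? deadline ρ)

  Feasible : ∀ {𝒯} → RequestSet 𝒯 → Schedule 𝒯 → Set (suc 0ℓ ⊔ a ⊔ ℓ₂)
  Feasible R Σ = All (λ ρ → Any (Satisfies ρ) Σ) (requests R)

  module _ {𝒯 : Tree} (c : Node 𝒯 → Cost) where

    Positive : Set (ℓ₃ ⊔ ℓ₄)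
    Positive = ∀ v → 0# < c v

    Increasing : Set ℓ₄
    Increasing = ∀ {u v} → u ≼ v → c u ≤ c v

    subtreeCost : Subtree 𝒯 → Cost
    subtreeCost S = sum (map c (filter (Subtree.member? S) (nodes 𝒯)))

    cost : Schedule 𝒯 → Cost
    cost Σ = sum (map (λ s → subtreeCost (subtree s)) Σ)

    record Optimal (R : RequestSet 𝒯) (O : Schedule 𝒯) : Set (suc 0ℓ ⊔ a ⊔ ℓ₂ ⊔ ℓ₄) where
      field
        feasible : Feasible R O
        minimal  : ∀ Σ → Feasible R Σ → cost O ≤ cost Σ

    -- The last field bounds the cost against every feasible schedule, so that
    -- the notion does not depend on an optimal schedule being exhibited.
    record Competitive (κ : Cost) (alg : RequestSet 𝒯 → Schedule 𝒯)
      : Set (suc 0ℓ ⊔ a ⊔ ℓ₁ ⊔ ℓ₂ ⊔ ℓ₄) where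
      field
        feasible    : ∀ R → Feasible R (alg R)
        ≤κ*optimal  : ∀ R O → Optimal R O → cost (alg R) ≤ κ * cost O
        ≤κ*feasible : ∀ R Σ → Feasible R Σ → cost (alg R) ≤ κ * cost Σ

  byDeadline : Tree → DecTotalOrder (a ⊔ ℓ₂) ℓ₁ ℓ₂
  byDeadline 𝒯 = On.decTotalOrder time (deadline {𝒯})

  -- The first argument is the list of services transmitted so far, latest
  -- first.
  noaddStep : ∀ {𝒯} → Schedule 𝒯 → Request 𝒯 → Schedule 𝒯
  noaddStep sent ρ =
    if does (any? (satisfies? ρ) sent)
    then sent
    else (path (location ρ) at deadline ρ) ∷ sent

  -- NOADD acts only when a deadline is reached, so running it amounts to
  -- going through the requests by increasing deadline.  The decision at
  -- deadline d uses only requests with deadline at most d, all of which have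
  -- arrived by then; this is why the algorithm is online.
  noadd : ∀ {𝒯} → RequestSet 𝒯 → Schedule 𝒯
  noadd {𝒯} R = foldl noaddStep [] (Sort.sort (byDeadline 𝒯) (requests R))

{-# OPTIONS --safe #-}

-- On an increasing tree the path P_ρ has at most D nodes, none dearer than the
-- location of ρ, so a transmission of NOADD costs at most D times the cost of
-- the location v of the request ρ that triggers it.  Charge c(v) to the node v
-- of a service (S , t) of the offline schedule that satisfies ρ.  No node of a
-- service is charged twice: if ρ and σ both trigger a transmission, are located
-- at v and are satisfied by (S , t), and d_ρ ≤ d_σ, then a_σ ≤ t ≤ d_ρ ≤ d_σ,
-- so (P_ρ , d_ρ) has already satisfied σ.
module Submission where

open import Level using (Level)
open import Relation.Binary.Bundles using (DecTotalOrder)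
open import Defs

open import Data.Bool.Base using (true; false)
open import Data.Fin.Base using (Fin; zero; suc)
open import Data.Fin.Properties using (suc-injective)
open import Data.List.Base using (List; []; _∷_; _++_; [_]; map; filter; foldl; foldr; tabulate; concat; length)
open import Data.List.Membership.Propositional using () renaming (_∈_ to _∈ˡ_)
open import Data.List.Membership.Propositional.Properties using (∈-∃++; ∈-++⁺ˡ; ∈-++⁺ʳ; ∈-++⁻; ∈-map⁺; ∈-map⁻; ∈-concat⁺′; ∈-tabulate⁺; ∈-filter⁺)
open import Data.List.Properties using (filter-++; filter-none; filter-≐; length-map; map-∘; ++-identityʳ)
open import Data.List.Relation.Binary.Permutation.Propositional using (↭-sym)
open import Data.List.Relation.Binary.Permutation.Propositional.Properties using (All-resp-↭)
open import Data.List.Relation.Binary.Subset.Propositional using (_⊆_)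
open import Data.List.Relation.Unary.All as All using (All; []; _∷_)
open import Data.List.Relation.Unary.AllPairs as AllPairs using (AllPairs; []; _∷_)
open import Data.List.Relation.Unary.Any using (Any; here; there; any?)
open import Data.List.Relation.Unary.Unique.Propositional using (Unique)
open import Data.Nat.Base as ℕ using (ℕ; z≤n; s≤s)
open import Data.Product.Base using (∃-syntax; _×_; _,_; proj₁)
open import Data.Sum.Base using (inj₁; inj₂)
open import Function.Base using (_∘_; _on_)
open import Relation.Binary.Bundles using (Poset)
open import Relation.Binary.PropositionalEquality as ≡ using (_≡_; _≢_)
open import Relation.Binary.Structures using (IsTotalOrder)
open import Relation.Nullary.Decidable.Core using (yes; no; does; ¬?)
open import Relation.Nullary.Negation.Core using (¬_; contradiction)
open import Relation.Unary using (Pred; Decidable)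
import Algebra.Properties.CommutativeSemigroup as CommutativeSemigroupProperties
import Algebra.Properties.Semiring.Mult as SemiringMult
import Data.List.Relation.Unary.All.Properties as All
import Data.List.Relation.Unary.AllPairs.Properties as AllPairs
import Data.List.Relation.Unary.Sorted.TotalOrder.Properties as Sorted
import Data.List.Sort as Sort
import Data.Nat.Properties as ℕ
import Relation.Binary.Reasoning.PartialOrder as PartialOrderReasoning

-- Lists

module _ {a p : Level} {A : Set a} {P : Pred A p} (P? : Decidable P) where

  filter-map : ∀ {b} {B : Set b} (f : B → A) xs →
               filter P? (map f xs) ≡ map f (filter (P? ∘ f) xs)
  filter-map f []       = ≡.refl
  filter-map f (x ∷ xs) with does (P? (f x))
  ... | true  = ≡.cong (f x ∷_) (filter-map f xs)
  ... | false = filter-map f xs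

  filter-concat-none : ∀ {xss} → All (All (¬_ ∘ P)) xss → filter P? (concat xss) ≡ []
  filter-concat-none = filter-none P? ∘ All.concat⁺

  -- A path enters only one child subtree of a node, so in the blocks of `nodes` only block `j` can
  -- contribute to it.
  filter-concat-tabulate : ∀ {n} (f : Fin n → List A) j →
                           (∀ i → i ≢ j → All (¬_ ∘ P) (f i)) →
                           filter P? (concat (tabulate f)) ≡ filter P? (f j)
  filter-concat-tabulate f zero none =
    ≡.trans (filter-++ P? (f zero) _)
      (≡.trans (≡.cong (filter P? (f zero) ++_)
                  (filter-concat-none (All.tabulate⁺ λ i → none (suc i) λ ())))
        (++-identityʳ _))
  filter-concat-tabulate f (suc j) none =
    ≡.trans (filter-++ P? (f zero) _)
      (≡.cong₂ _++_ (filter-none P? (none zero λ ()))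
        (filter-concat-tabulate (f ∘ suc) j λ i i≢j → none (suc i) (i≢j ∘ suc-injective)))

-- Trees

≼-refl : ∀ {𝒯} {v : Node 𝒯} → v ≼ v
≼-refl {v = root}      = root≼
≼-refl {v = child i v} = child≼ ≼-refl

child≼⁻ : ∀ {k ts i} {u v : Node (ts i)} → child {k} {ts} i u ≼ child i v → u ≼ v
child≼⁻ (child≼ u≼v) = u≼v

∈-nodes : ∀ {𝒯} (v : Node 𝒯) → v ∈ˡ nodes 𝒯
∈-nodes root        = here ≡.refl
∈-nodes (child i v) =
  there (∈-concat⁺′ (∈-map⁺ (child i) (∈-nodes v)) (∈-tabulate⁺ i))

filter-≼root : ∀ {k ts} → filter (_≼? root) (nodes (node k ts)) ≡ root ∷ []
filter-≼root {k} {ts} = ≡.cong (root ∷_)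
  (filter-concat-none (_≼? root) (All.tabulate⁺ no-child))
  where
  no-child : ∀ i → All (λ u → ¬ (u ≼ root)) (map (child {k} {ts} i) (nodes (ts i)))
  no-child i = All.map⁺ (All.universal (λ _ ()) _)

-- This is the recursion on which the count of path nodes runs: descending from the root costs one
-- node and leaves a path in the child's own tree.
filter-≼child : ∀ {k ts} j (v : Node (ts j)) →
                filter (_≼? child j v) (nodes (node k ts)) ≡
                root ∷ map (child j) (filter (_≼? v) (nodes (ts j)))
filter-≼child {k} {ts} j v = ≡.cong (root ∷_) (begin
  filter (_≼? child j v) (concat (tabulate λ i → map (child i) (nodes (ts i))))
    ≡⟨ filter-concat-tabulate (_≼? child j v) _ j other-branch ⟩
  filter (_≼? child j v) (map (child j) (nodes (ts j)))
    ≡⟨ filter-map (_≼? child j v) (child j) (nodes (ts j)) ⟩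
  map (child j) (filter (λ u → child j u ≼? child j v) (nodes (ts j)))
    -- The test on the left is stuck on `j ≟ j`, so the two deciders are exchanged through the
    -- equivalence of their predicates.
    ≡⟨ ≡.cong (map (child j))
         (filter-≐ (λ u → child {ts = ts} j u ≼? child j v) (_≼? v) (child≼⁻ , child≼) (nodes (ts j))) ⟩
  map (child j) (filter (_≼? v) (nodes (ts j))) ∎)
  where
  open ≡.≡-Reasoning
  other-branch : ∀ i → i ≢ j → All (λ u → ¬ (u ≼ child j v)) (map (child i) (nodes (ts i)))
  other-branch i i≢j =
    All.map⁺ (All.universal (λ { _ (child≼ _) → i≢j ≡.refl }) _)

≤-max-tabulate : ∀ {n} (f : Fin n → ℕ) i → f i ℕ.≤ foldr ℕ._⊔_ 0 (tabulate f)
≤-max-tabulate f zero    = ℕ.m≤m⊔n (f zero) _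
≤-max-tabulate f (suc i) = ℕ.≤-trans (≤-max-tabulate (f ∘ suc) i) (ℕ.m≤n⊔m (f zero) _)

-- Induction on the node: the root of the path matches the `suc` in `depth`, and the rest of the
-- path lies in one child, whose depth is at most the maximum.
length-path≤depth : ∀ {𝒯} (v : Node 𝒯) → length (filter (_≼? v) (nodes 𝒯)) ℕ.≤ depth 𝒯
length-path≤depth {node k ts} root =
  ≡.subst (λ us → length us ℕ.≤ depth (node k ts)) (≡.sym (filter-≼root {k} {ts})) (s≤s z≤n)
length-path≤depth {node k ts} (child j v) =
  ≡.subst (λ us → length us ℕ.≤ depth (node k ts)) (≡.sym (filter-≼child j v))
    (s≤s (≡.subst (ℕ._≤ _) (≡.sym (length-map (child {ts = ts} j) (filter (_≼? v) (nodes (ts j)))))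
      (ℕ.≤-trans (length-path≤depth v) (≤-max-tabulate (depth ∘ ts) j))))

-- Sums in ordered rings

module OrderedRingSums {b ℓ₃ ℓ₄ : Level} (K : OrderedCommutativeRing b ℓ₃ ℓ₄) where

  open OrderedCommutativeRing K
  open CommutativeSemigroupProperties +-commutativeSemigroup using (x∙yz≈y∙xz)
  open SemiringMult semiring using (×-assoc-*; ×-congʳ) renaming (_×_ to _×ⁿ_)

  poset : Poset b ℓ₃ ℓ₄
  poset = record { isPartialOrder = IsTotalOrder.isPartialOrder isTotalOrder }

  open Poset poset using () renaming (refl to ≤-refl)
  open PartialOrderReasoning poset

  +-monoʳ-≤ : ∀ z {x y} → x ≤ y → z + x ≤ z + y
  +-monoʳ-≤ z {x} {y} x≤y = begin
    z + x ≈⟨ +-comm z x ⟩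
    x + z ≤⟨ +-monoˡ-≤ z x≤y ⟩
    y + z ≈⟨ +-comm y z ⟩
    z + y ∎

  +-mono-≤ : ∀ {w x y z} → w ≤ x → y ≤ z → w + y ≤ x + z
  +-mono-≤ {w} {x} {y} {z} w≤x y≤z = begin
    w + y ≤⟨ +-monoˡ-≤ y w≤x ⟩
    x + y ≤⟨ +-monoʳ-≤ x y≤z ⟩
    x + z ∎

  x≤y+x : ∀ {x y} → 0# ≤ y → x ≤ y + x
  x≤y+x {x} {y} 0≤y = begin
    x      ≈⟨ +-identityˡ x ⟨
    0# + x ≤⟨ +-monoˡ-≤ x 0≤y ⟩
    y + x  ∎

  ×-nonNeg : ∀ n {x} → 0# ≤ x → 0# ≤ n ×ⁿ x
  ×-nonNeg ℕ.zero    0≤x = ≤-refl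
  ×-nonNeg (ℕ.suc n) {x} 0≤x = begin
    0#         ≤⟨ ×-nonNeg n 0≤x ⟩
    n ×ⁿ x     ≤⟨ x≤y+x 0≤x ⟩
    x + n ×ⁿ x ∎

  ×-monoˡ-≤ : ∀ {m n x} → 0# ≤ x → m ℕ.≤ n → m ×ⁿ x ≤ n ×ⁿ x
  ×-monoˡ-≤ {n = n} 0≤x z≤n = ×-nonNeg n 0≤x
  ×-monoˡ-≤ {x = x} 0≤x (s≤s m≤n) = +-monoʳ-≤ x (×-monoˡ-≤ 0≤x m≤n)

  ×-monoʳ-≤ : ∀ n {x y} → x ≤ y → n ×ⁿ x ≤ n ×ⁿ y
  ×-monoʳ-≤ ℕ.zero    x≤y = ≤-refl
  ×-monoʳ-≤ (ℕ.suc n) x≤y = +-mono-≤ x≤y (×-monoʳ-≤ n x≤y)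

  -- Reading the factor as repeated addition reduces the bounds involving `fromℕ` to inductions that
  -- compare summands.
  fromℕ-* : ∀ n x → fromℕ n * x ≈ n ×ⁿ x
  fromℕ-* n x = trans (×-assoc-* n 1# x) (×-congʳ n (*-identityˡ x))

  fromℕ-*-monoʳ-≤ : ∀ n {x y} → x ≤ y → fromℕ n * x ≤ fromℕ n * y
  fromℕ-*-monoʳ-≤ n {x} {y} x≤y = begin
    fromℕ n * x ≈⟨ fromℕ-* n x ⟩
    n ×ⁿ x      ≤⟨ ×-monoʳ-≤ n x≤y ⟩
    n ×ⁿ y      ≈⟨ fromℕ-* n y ⟨
    fromℕ n * y ∎

  module _ {a : Level} {A : Set a} where

    sum-mono-≤ : ∀ {f g : A → Carrier} → (∀ x → f x ≤ g x) → ∀ xs →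
                 sum (map f xs) ≤ sum (map g xs)
    sum-mono-≤ f≤g []       = ≤-refl
    sum-mono-≤ f≤g (x ∷ xs) = +-mono-≤ (f≤g x) (sum-mono-≤ f≤g xs)

    sum-*ˡ : ∀ k (f : A → Carrier) xs → sum (map (λ x → k * f x) xs) ≈ k * sum (map f xs)
    sum-*ˡ k f []       = sym (zeroʳ k)
    sum-*ˡ k f (x ∷ xs) = trans (+-congˡ (sum-*ˡ k f xs)) (sym (distribˡ k (f x) _))

    sum≤length× : ∀ {f : A → Carrier} {y xs} → All (λ x → f x ≤ y) xs →
                  sum (map f xs) ≤ length xs ×ⁿ y
    sum≤length× []           = ≤-refl
    sum≤length× (fx≤y ∷ all) = +-mono-≤ fx≤y (sum≤length× all)

    sum-nonNeg : ∀ {f : A → Carrier} → (∀ x → 0# ≤ f x) → ∀ xs → 0# ≤ sum (map f xs)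
    sum-nonNeg 0≤f []       = ≤-refl
    sum-nonNeg {f} 0≤f (x ∷ xs) = begin
      0#                   ≤⟨ sum-nonNeg 0≤f xs ⟩
      sum (map f xs)       ≤⟨ x≤y+x (0≤f x) ⟩
      f x + sum (map f xs) ∎

    sum-insert : ∀ (f : A → Carrier) xs {y zs} →
                 sum (map f (xs ++ [ y ] ++ zs)) ≈ f y + sum (map f (xs ++ zs))
    sum-insert f []       = refl
    sum-insert f (x ∷ xs) = trans (+-congˡ (sum-insert f xs)) (x∙yz≈y∙xz (f x) _ _)

    -- Used to split the charges into those paid by one service and those left to the remaining
    -- services.
    sum-filter-¬ : ∀ {p} {P : Pred A p} (P? : Decidable P) (f : A → Carrier) xs →
                   sum (map f xs) ≈
                   sum (map f (filter P? xs)) + sum (map f (filter (¬? ∘ P?) xs))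
    sum-filter-¬ P? f []       = sym (+-identityˡ 0#)
    sum-filter-¬ P? f (x ∷ xs) with does (P? x)
    ... | true  = trans (+-congˡ (sum-filter-¬ P? f xs)) (sym (+-assoc _ _ _))
    ... | false = trans (+-congˡ (sum-filter-¬ P? f xs)) (x∙yz≈y∙xz (f x) _ _)

    -- Match the head of `xs` with an occurrence in `ys`, delete both and recurse; what is left of
    -- `ys` at the end is nonnegative.
    unique⇒sum-mono-⊆ : ∀ {f : A → Carrier} → (∀ x → 0# ≤ f x) → ∀ {xs ys} →
                        Unique xs → xs ⊆ ys → sum (map f xs) ≤ sum (map f ys)
    unique⇒sum-mono-⊆ 0≤f {ys = ys} [] xs⊆ys = sum-nonNeg 0≤f ys
    unique⇒sum-mono-⊆ {f} 0≤f {x ∷ xs} (x∉xs ∷ xs!) xs⊆ys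
      with us , vs , ≡.refl ← ∈-∃++ (xs⊆ys (here ≡.refl)) = begin
        f x + sum (map f xs)           ≤⟨ +-monoʳ-≤ (f x) (unique⇒sum-mono-⊆ 0≤f xs! xs⊆us++vs) ⟩
        f x + sum (map f (us ++ vs))   ≈⟨ sum-insert f us ⟨
        sum (map f (us ++ [ x ] ++ vs)) ∎
      where
      xs⊆us++vs : xs ⊆ us ++ vs
      xs⊆us++vs y∈xs with ∈-++⁻ us (xs⊆ys (there y∈xs))
      ... | inj₁ y∈us         = ∈-++⁺ˡ y∈us
      -- An element of the tail that fell on the deleted occurrence would repeat the head, against
      -- uniqueness.
      ... | inj₂ (here y≡x)   = contradiction (≡.sym y≡x) (All.lookup x∉xs y∈xs)
      ... | inj₂ (there y∈vs) = ∈-++⁺ʳ us y∈vs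

-- NOADD

module NoaddAnalysis
  {a ℓ₁ ℓ₂ b ℓ₃ ℓ₄ : Level}
  (time : DecTotalOrder a ℓ₁ ℓ₂)
  (K : OrderedCommutativeRing b ℓ₃ ℓ₄)
  where

  open MLAPD time K
  open OrderedRingSums K
  open OrderedCommutativeRing K using (_+_)
  open DecTotalOrder time using () renaming (refl to ≤ᵗ-refl; trans to ≤ᵗ-trans)

  -- Feasibility of the run and the requests that trigger its transmissions.

  module _ {𝒯 : Tree} where

    transmit : Request 𝒯 → Service 𝒯
    transmit ρ = path (location ρ) at deadline ρ

    transmit-satisfies : ∀ ρ → Satisfies ρ (transmit ρ)
    transmit-satisfies ρ = ≼-refl , arrival≤deadline ρ , ≤ᵗ-refl

    noaddStep-extends : ∀ {p} {P : Pred (Service 𝒯) p} sent ρ →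
                        Any P sent → Any P (noaddStep sent ρ)
    noaddStep-extends sent ρ with does (any? (satisfies? ρ) sent)
    ... | true  = λ p → p
    ... | false = there

    noaddStep-satisfies : ∀ sent ρ → Any (Satisfies ρ) (noaddStep sent ρ)
    noaddStep-satisfies sent ρ with any? (satisfies? ρ) sent
    ... | yes p = p
    ... | no  _ = here (transmit-satisfies ρ)

    noaddRun-extends : ∀ {p} {P : Pred (Service 𝒯) p} ρs {sent} →
                       Any P sent → Any P (foldl noaddStep sent ρs)
    noaddRun-extends []       p = p
    noaddRun-extends (ρ ∷ ρs) p = noaddRun-extends ρs (noaddStep-extends _ ρ p)

    noaddRun-satisfies : ∀ ρs sent → All (λ ρ → Any (Satisfies ρ) (foldl noaddStep sent ρs)) ρs
    noaddRun-satisfies []       sent = []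
    noaddRun-satisfies (ρ ∷ ρs) sent =
      noaddRun-extends ρs (noaddStep-satisfies sent ρ) ∷ noaddRun-satisfies ρs _

    noadd-feasible : ∀ (R : RequestSet 𝒯) → Feasible R (noadd R)
    noadd-feasible R =
      -- The run goes through the sorted list, a permutation of the requests.
      All-resp-↭ (Sort.sort-↭ (byDeadline 𝒯) (requests R)) (noaddRun-satisfies _ [])

    -- This is what keeps a node of a service from being charged twice. Quantifying over every
    -- service makes it a property of the run alone, independent of the offline schedule.
    Separated : Request 𝒯 → Request 𝒯 → Set _
    Separated ρ σ = location ρ ≡ location σ → ∀ s → Satisfies ρ s → ¬ Satisfies σ s

    -- A common service at time t would give `arrival ρ` ≤ t ≤ `deadline τ` ≤ `deadline ρ`, so the
    -- transmission for `τ` would have satisfied `ρ`.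
    unsatisfied⇒separated : ∀ {ρ τ} → deadline τ ≤ᵗ deadline ρ →
                            ¬ Satisfies ρ (transmit τ) → Separated ρ τ
    unsatisfied⇒separated τ≤ρ ¬sat ≡.refl s (_ , aρ≤t , _) (_ , _ , t≤dτ) =
      ¬sat (≼-refl , ≤ᵗ-trans aρ≤t t≤dτ , τ≤ρ)

    -- Loop invariant: `τs` lists the requests that have triggered so far, latest first, and the
    -- services sent are exactly their transmissions. The predicate `Q` carries along whatever is
    -- known of the input requests.
    noaddRun-triggers :
      ∀ {q} {Q : Pred (Request 𝒯) q} ρs τs →
      AllPairs (_≤ᵗ_ on deadline) ρs →
      All (λ ρ → All (λ τ → deadline τ ≤ᵗ deadline ρ) τs) ρs →
      All Q ρs → All Q τs → AllPairs Separated τs →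
      ∃[ σs ] foldl noaddStep (map transmit τs) ρs ≡ map transmit σs ×
              All Q σs × AllPairs Separated σs
    noaddRun-triggers []       τs _ _ _ qτ sepτ = τs , ≡.refl , qτ , sepτ
    noaddRun-triggers (ρ ∷ ρs) τs (ρ≤ρs ∷ sorted) (τs≤ρ ∷ τs≤ρs) (qρ ∷ qρs) qτ sepτ
      with any? (satisfies? ρ) (map transmit τs)
    ... | yes _   = noaddRun-triggers ρs τs sorted τs≤ρs qρs qτ sepτ
    ... | no ¬sat =
      noaddRun-triggers ρs (ρ ∷ τs) sorted
        -- Since the pending requests are sorted, the new trigger `ρ` is also due no later than any
        -- of them.
        (All.zipWith (λ (ρ≤ , τs≤) → ρ≤ ∷ τs≤) (ρ≤ρs , τs≤ρs)) qρs (qρ ∷ qτ)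
        -- `ρ` triggers because no earlier transmission satisfies it, which separates it from each
        -- earlier trigger.
        (All.zipWith (λ {τ} (τ≤ρ , ¬satτ) → unsatisfied⇒separated {ρ} {τ} τ≤ρ ¬satτ)
           (τs≤ρ , All.map⁻ (All.¬Any⇒All¬ _ ¬sat)) ∷ sepτ)

    noadd-triggers :
      ∀ {q} {Q : Pred (Request 𝒯) q} R → All Q (requests R) →
      ∃[ σs ] noadd R ≡ map transmit σs × All Q σs × AllPairs Separated σs
    noadd-triggers R q =
      noaddRun-triggers (sort (requests R)) []
        (Sorted.Sorted⇒AllPairs (DecTotalOrder.totalOrder (byDeadline 𝒯)) (sort-↗ (requests R)))
        (All.universal (λ _ → []) _)
        (All-resp-↭ (↭-sym (sort-↭ (requests R))) q) [] []
      where
      open Sort (byDeadline 𝒯) using (sort; sort-↗; sort-↭)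

    -- Charging the transmissions to a feasible schedule.

    module _ (c : Node 𝒯 → Cost) (0≤c : ∀ v → 0# ≤ c v) where

      open PartialOrderReasoning poset

      -- Monotonicity bounds every node of the path by its last one, and nonnegativity allows the
      -- number of nodes to be raised to the depth.
      pathCost≤ : Increasing c → ∀ v → subtreeCost c (path v) ≤ fromℕ (depth 𝒯) * c v
      pathCost≤ c-mono v = begin
        subtreeCost c (path v)    ≤⟨ sum≤length× (All.map c-mono (All.all-filter (_≼? v) (nodes 𝒯))) ⟩
        length (filter (_≼? v) (nodes 𝒯)) ×ⁿ c v
                                  ≤⟨ ×-monoˡ-≤ (0≤c v) (length-path≤depth v) ⟩
        depth 𝒯 ×ⁿ c v            ≈⟨ fromℕ-* (depth 𝒯) (c v) ⟨
        fromℕ (depth 𝒯) * c v     ∎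
        where open SemiringMult (OrderedCommutativeRing.semiring K) using () renaming (_×_ to _×ⁿ_)

      -- Separated requests satisfied by the same service cannot share a location, so their
      -- locations are distinct nodes of its subtree, each paid for there.
      satisfied-cost≤ : ∀ s {σs} → All (λ σ → Satisfies σ s) σs → AllPairs Separated σs →
                        sum (map (c ∘ location) σs) ≤ subtreeCost c (subtree s)
      satisfied-cost≤ s {σs} sat sep = begin
        sum (map (c ∘ location) σs)     ≡⟨ ≡.cong sum (map-∘ σs) ⟩
        sum (map c (map location σs))   ≤⟨ unique⇒sum-mono-⊆ 0≤c (AllPairs.map⁺ (distinct sat sep)) locations⊆ ⟩
        subtreeCost c (subtree s)       ∎
        where
        distinct : ∀ {ρs} → All (λ σ → Satisfies σ s) ρs → AllPairs Separated ρs →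
                   AllPairs (_≢_ on location) ρs
        distinct []           []           = []
        distinct (satρ ∷ sat) (sepρ ∷ sep) =
          All.zipWith (λ (satσ , sepσ) loc≡ → sepσ loc≡ s satρ satσ) (sat , sepρ) ∷ distinct sat sep

        locations⊆ : map location σs ⊆ filter (Subtree.member? (subtree s)) (nodes 𝒯)
        locations⊆ v∈ with σ , σ∈ , ≡.refl ← ∈-map⁻ location v∈ =
          ∈-filter⁺ _ (∈-nodes (location σ)) (proj₁ (All.lookup sat σ∈))

      -- Induction on the schedule: each request is charged to the first service in the list that
      -- satisfies it, and both filtered lists inherit separation.
      separated-cost≤ : ∀ O {σs} → All (λ σ → Any (Satisfies σ) O) σs → AllPairs Separated σs →
                        sum (map (c ∘ location) σs) ≤ cost c O
      separated-cost≤ []      []         _   = Poset.refl poset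
      separated-cost≤ []      (() ∷ _)   _
      separated-cost≤ (s ∷ O) {σs} sat sep = begin
        sum (map (c ∘ location) σs)
          ≈⟨ sum-filter-¬ by-s? (c ∘ location) σs ⟩
        sum (map (c ∘ location) (filter by-s? σs)) +
          sum (map (c ∘ location) (filter (¬? ∘ by-s?) σs))
          ≤⟨ +-mono-≤
               (satisfied-cost≤ s (All.all-filter by-s? σs) (AllPairs.filter⁺ by-s? sep))
               (separated-cost≤ O satisfied-later (AllPairs.filter⁺ (¬? ∘ by-s?) sep)) ⟩
        cost c (s ∷ O) ∎
        where
        by-s? : Decidable (λ σ → Satisfies σ s)
        by-s? σ = satisfies? σ s

        drop-here : ∀ σ → Any (Satisfies σ) (s ∷ O) × ¬ Satisfies σ s → Any (Satisfies σ) O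
        drop-here σ (here p  , ¬p) = contradiction p ¬p
        drop-here σ (there p , _)  = p

        satisfied-later : All (λ σ → Any (Satisfies σ) O) (filter (¬? ∘ by-s?) σs)
        satisfied-later = All.zipWith (λ {σ} → drop-here σ)
          (All.filter⁺ (¬? ∘ by-s?) sat , All.all-filter (¬? ∘ by-s?) σs)

      noadd-cost≤ : Increasing c → ∀ R O → Feasible R O →
                    cost c (noadd R) ≤ fromℕ (depth 𝒯) * cost c O
      noadd-cost≤ c-mono R O feasible
        -- Here `Q` is satisfaction by some service of `O`, so feasibility of `O` passes to the
        -- triggers.
        with σs , noadd≡ , sat , sep ← noadd-triggers R feasible = begin
          cost c (noadd R)
            ≡⟨ ≡.cong (cost c) noadd≡ ⟩
          cost c (map transmit σs)
            ≡⟨ ≡.cong sum (map-∘ σs) ⟨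
          sum (map (λ σ → subtreeCost c (path (location σ))) σs)
            ≤⟨ sum-mono-≤ (pathCost≤ c-mono ∘ location) σs ⟩
          sum (map (λ σ → fromℕ (depth 𝒯) * c (location σ)) σs)
            ≈⟨ sum-*ˡ (fromℕ (depth 𝒯)) (c ∘ location) σs ⟩
          fromℕ (depth 𝒯) * sum (map (c ∘ location) σs)
            ≤⟨ fromℕ-*-monoʳ-≤ (depth 𝒯) (separated-cost≤ O sat sep) ⟩
          fromℕ (depth 𝒯) * cost c O ∎

mainTheorem1 : ∀ {a ℓ₁ ℓ₂ b ℓ₃ ℓ₄ : Level}
    (time : DecTotalOrder a ℓ₁ ℓ₂) (K : OrderedCommutativeRing b ℓ₃ ℓ₄) →
    let open MLAPD time K in
    (𝒯 : Tree) (c : Node 𝒯 → Cost) →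
    Positive c → Increasing c →
    Competitive c (fromℕ (depth 𝒯)) noadd
mainTheorem1 time K 𝒯 c c-pos c-mono = record
  { feasible    = noadd-feasible
  -- An optimal schedule is in particular feasible, so the same bound applies.
  ; ≤κ*optimal  = λ R O O-opt → bound R O (MLAPD.Optimal.feasible O-opt)
  ; ≤κ*feasible = bound
  }
  where
  open NoaddAnalysis time K
  -- The first component of strict positivity is the nonnegativity that the charging argument takes.
  bound = noadd-cost≤ c (proj₁ ∘ c-pos) c-mono
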